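{- Let $\mathcal{G}$ be a finite graph (i.e. a graph with finitely many vertices). If $\mathcal{G}$ is rotarily transitive, then $\mathcal{G}$ has exactly $1$ vertex.
   Context: A graph is a pair $\mathcal{G}=(V,E)$ where $V$ is a set (of vertices) and $E$ (the edges) is a set of subsets of $V$ having exactly two elements. An automorphism of $\mathcal{G}$ is a bijection $\varphi:V\to V$ such that for all $u,v\in V$, $\{u,v\}\in E \iff \{\varphi(u),\varphi(v)\}\in E$; these form the group $\mathrm{Aut}(\mathcal{G})$. A group $G$ acting on the graph $\mathcal{G}$ means a group morphism $G\to \mathrm{Aut}(\mathcal{G})$, i.e. a left action of $G$ on $V$ by graph automorphisms. A group action of $G$ on a set $X$ is transitive if for all $x,y\in X$ there is $g\in G$ with $g\cdot x=y$. It is by rotations if every $g\in G$ (including the identity) has at least one fixed point in $X$ (so in particular $X\neq\varnothing$). It is rotarily transitive if it is both transitive and by rotations. A graph is rotarily transitive if there exist a group $G$ and a rotarily transitive action of $G$ on its vertex set by graph automorphisms. -}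

module Defs where

open import Algebra.Bundles using (Group)
open import Algebra.Morphism.Structures using (module GroupMorphisms)
open import Data.Fin.Base using (Fin)
open import Data.Nat.Base using (ℕ)
open import Data.Product.Base using (Σ-syntax; ∃-syntax; _×_; _,_; proj₁; proj₂)
open import Function.Bundles using (_⤖_; _⇔_; mk⇔; Bijection)
open import Function.Construct.Composition using (_⤖-∘_; _⇔-∘_)
open import Function.Construct.Identity using (⤖-id; ⇔-id)
open import Function.Construct.Symmetry using (⤖-sym; ⇔-sym)
open import Level using (Level; _⊔_; suc)
open import Relation.Binary.Core using (Rel)
open import Relation.Binary.Definitions using (Irreflexive; Symmetric)
open import Relation.Binary.PropositionalEquality
  using (_≡_; _≗_; refl; sym; trans; cong; subst₂)

private
  variable
    a e c ℓ x : Level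

HasCardinality : Set x → ℕ → Set x
HasCardinality X n = X ⤖ Fin n

Finite : Set x → Set x
Finite X = ∃[ n ] HasCardinality X n

-- A set of two-element subsets of V is given by the relation
-- "{u , v} is an edge", which is symmetric because {u , v} = {v , u}, and
-- irreflexive because {u , u} does not have two elements.
record Graph a e : Set (suc (a ⊔ e)) where
  field
    V      : Set a
    Edge   : Rel V e
    symm   : Symmetric Edge
    irrefl : Irreflexive _≡_ Edge

module _ (𝒢 : Graph a e) where
  open Graph 𝒢

  record Automorphism : Set (a ⊔ e) where
    field
      bijection : V ⤖ V

    open Bijection bijection public using (to; injective; surjective)

    field
      edge-⇔ : ∀ u v → Edge u v ⇔ Edge (to u) (to v)

module _ {𝒢 : Graph a e} where
  open Graph 𝒢
  open Automorphism

  -- Equality of automorphisms is equality of the underlying maps V → V.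
  infix 4 _≈ᴬ_
  _≈ᴬ_ : Rel (Automorphism 𝒢) a
  φ ≈ᴬ ψ = to φ ≗ to ψ

  idᴬ : Automorphism 𝒢
  idᴬ = record
    { bijection = ⤖-id V
    ; edge-⇔    = λ u v → ⇔-id (Edge u v)
    }

  infixr 9 _∘ᴬ_
  _∘ᴬ_ : Automorphism 𝒢 → Automorphism 𝒢 → Automorphism 𝒢
  φ ∘ᴬ ψ = record
    { bijection = bijection φ ⤖-∘ bijection ψ
    ; edge-⇔    = λ u v → edge-⇔ φ (to ψ u) (to ψ v) ⇔-∘ edge-⇔ ψ u v
    }

  private
    from : Automorphism 𝒢 → V → V
    from φ = Bijection.to (⤖-sym (bijection φ))

  to∘from : ∀ φ v → to φ (from φ v) ≡ v
  to∘from φ v = proj₂ (surjective φ v) refl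

  from∘to : ∀ φ v → from φ (to φ v) ≡ v
  from∘to φ v = injective φ (to∘from φ (to φ v))

  _⁻¹ᴬ : Automorphism 𝒢 → Automorphism 𝒢
  φ ⁻¹ᴬ = record
    { bijection = ⤖-sym (bijection φ)
    ; edge-⇔    = λ u v → ⇔-sym (edge-⇔ φ (from φ u) (from φ v)) ⇔-∘
        mk⇔ (subst₂ Edge (sym (to∘from φ u)) (sym (to∘from φ v)))
            (subst₂ Edge (to∘from φ u) (to∘from φ v))
    }

Aut : Graph a e → Group (a ⊔ e) a
Aut 𝒢 = record
  { Carrier = Automorphism 𝒢
  ; _≈_     = _≈ᴬ_
  ; _∙_     = _∘ᴬ_
  ; ε       = idᴬ
  ; _⁻¹     = _⁻¹ᴬ
  ; isGroup = record
    { isMonoid = record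
      { isSemigroup = record
        { isMagma = record
          { isEquivalence = record
            { refl  = λ _ → refl
            ; sym   = λ p v → sym (p v)
            ; trans = λ p q v → trans (p v) (q v)
            }
          ; ∙-cong = λ {φ} {_} {_} {ψ′} p q v →
              trans (cong (to φ) (q v)) (p (to ψ′ v))
          }
        ; assoc = λ _ _ _ _ → refl
        }
      ; identity = (λ _ _ → refl) , (λ _ _ → refl)
      }
    ; inverse = from∘to , to∘from
    ; ⁻¹-cong = λ {φ} {ψ} p v → injective φ
        (trans (to∘from φ v)
          (sym (trans (p (to (ψ ⁻¹ᴬ) v)) (to∘from ψ v))))
    }
  }
  where open Automorphism

record GraphAction (G : Group c ℓ) (𝒢 : Graph a e) : Set (a ⊔ e ⊔ c ⊔ ℓ) where
  open GroupMorphisms (Group.rawGroup G) (Group.rawGroup (Aut 𝒢))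

  field
    ρ              : Group.Carrier G → Automorphism 𝒢
    isHomomorphism : IsGroupHomomorphism ρ

  infixr 8 _·_
  _·_ : Group.Carrier G → Graph.V 𝒢 → Graph.V 𝒢
  g · v = Automorphism.to (ρ g) v

module _ {G : Set c} {X : Set x} (_·_ : G → X → X) where

  Transitive : Set (c ⊔ x)
  Transitive = ∀ x y → ∃[ g ] g · x ≡ y

  ByRotations : Set (c ⊔ x)
  ByRotations = ∀ g → ∃[ x ] g · x ≡ x

  RotarilyTransitive : Set (c ⊔ x)
  RotarilyTransitive = Transitive × ByRotations

-- The levels c and ℓ bound the size of the groups that may act.
RotarilyTransitiveGraph : ∀ c ℓ → Graph a e → Set (a ⊔ e ⊔ suc (c ⊔ ℓ))
RotarilyTransitiveGraph c ℓ 𝒢 =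
  Σ[ G ∈ Group c ℓ ] Σ[ α ∈ GraphAction G 𝒢 ] RotarilyTransitive (GraphAction._·_ α)

-- Burnside's count. Let H be the image of the group in the self-maps of the
-- n vertices. Left translation by an element moving y to y′ shows that the
-- number of h ∈ H with h x = y does not depend on y, so it is |H| / n. Summing
-- over x = y, the elements of H have |H| fixed points in total. Each has at
-- least one, hence each has exactly one; but the identity has n.
--
-- Membership in H need not be decidable. It concerns only the finitely many
-- self-maps of Fin n, so it is decidable up to double negation, and n ≡ 1 is
-- stable under double negation.
module Submission where

open import Defs

open import Algebra.Bundles using (Group)
open import Algebra.Morphism.Structures using (module GroupMorphisms)
open import Data.Bool.Base using (if_then_else_)
open import Data.Fin.Base using (Fin; zero; suc; finToFun; funToFin; combine)
open import Data.Fin.Permutation using (Permutation′; permutation; _⟨$⟩ʳ_)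
open import Data.Fin.Properties
  using (_≟_; sequence; finToFun-funToFin; funToFin-finToFin; nonZeroIndex)
open import Data.Nat.Base
  using (ℕ; zero; suc; _+_; _*_; _^_; _≤_; z≤n; NonZero)
open import Data.Nat.Properties as ℕ
  using (+-0-commutativeMonoid; +-*-semiring)
open import Data.Product.Base using (∃-syntax; _×_; _,_; proj₁; proj₂)
open import Effect.Monad using (RawMonad)
open import Function.Base using (_∘_; id)
open import Function.Bundles using (Bijection; _⇔_; mk⇔)
open import Function.Construct.Symmetry using (⤖-sym)
open import Level using (Level)
open import Relation.Binary.PropositionalEquality
open import Relation.Nullary.Decidable
  using (Dec; does; yes; no; decidable-stable; dec-true; does-⇔; ¬¬-excluded-middle)
open import Relation.Nullary.Negation using (¬_; ¬¬-Monad; ¬¬-map)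

open import Algebra.Properties.CommutativeMonoid.Sum +-0-commutativeMonoid
  using (sum; sum-syntax; sum-cong-≗; sum-replicate-zero; ∑-comm; ∑-permute)
open import Algebra.Properties.Semiring.Sum +-*-semiring using (*-distribˡ-sum)

private
  variable
    a b c ℓ : Level
    A : Set a
    B : Set b
    m n : ℕ

-- Sums of natural numbers over `Fin n`.

sum-const : ∀ n x → ∑[ i < n ] x ≡ n * x
sum-const zero    x = refl
sum-const (suc n) x = cong (x +_) (sum-const n x)

sum-mono-≤ : (f g : Fin n → ℕ) → (∀ i → f i ≤ g i) → sum f ≤ sum g
sum-mono-≤ {zero}  f g f≤g = z≤n
sum-mono-≤ {suc n} f g f≤g =
  ℕ.+-mono-≤ (f≤g zero) (sum-mono-≤ (f ∘ suc) (g ∘ suc) (f≤g ∘ suc))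

term≤sum : (f : Fin n → ℕ) → ∀ i → f i ≤ sum f
term≤sum f zero    = ℕ.m≤m+n _ _
term≤sum f (suc i) = ℕ.≤-trans (term≤sum (f ∘ suc) i) (ℕ.m≤n+m _ (f zero))

+-mono-≤-tight : ∀ {p q r s} → p ≤ q → r ≤ s → p + r ≡ q + s → p ≡ q × r ≡ s
+-mono-≤-tight {p} {q} {r} {s} p≤q r≤s eq =
  p≡q , ℕ.+-cancelˡ-≡ p r s (trans eq (cong (_+ s) (sym p≡q)))
  where
  p≡q : p ≡ q
  p≡q = ℕ.≤-antisym p≤q (ℕ.+-cancelʳ-≤ r q p
    (ℕ.≤-trans (ℕ.+-monoʳ-≤ q r≤s) (ℕ.≤-reflexive (sym eq))))

-- No summand can fall short, because no other summand could make up for it. This is what turns an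
-- average of one fixed point into exactly one for each map.
sum-mono-≤-tight : (f g : Fin n → ℕ) → (∀ i → f i ≤ g i) → sum f ≡ sum g → f ≗ g
sum-mono-≤-tight {zero}  f g f≤g eq ()
sum-mono-≤-tight {suc n} f g f≤g eq = λ where
    zero    → proj₁ head-tail
    (suc i) → sum-mono-≤-tight (f ∘ suc) (g ∘ suc) (f≤g ∘ suc) (proj₂ head-tail) i
  where
  head-tail : f zero ≡ g zero × sum (f ∘ suc) ≡ sum (g ∘ suc)
  head-tail =
    +-mono-≤-tight (f≤g zero) (sum-mono-≤ (f ∘ suc) (g ∘ suc) (f≤g ∘ suc)) eq

-- Indicators and numbers of fixed points.

𝟙 : Dec A → ℕ
𝟙 a? = if does a? then 1 else 0

𝟙-cong : A ⇔ B → (a? : Dec A) (b? : Dec B) → 𝟙 a? ≡ 𝟙 b?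
𝟙-cong A⇔B a? b? = cong (if_then 1 else 0) (does-⇔ A⇔B a? b?)

𝟙-true : (a? : Dec A) → A → 𝟙 a? ≡ 1
𝟙-true a? p = cong (if_then 1 else 0) (dec-true a? p)

-- Both clauses rest on computation: `does (suc i ≟ suc j)` reduces to `does (i ≟ j)`, and the mixed
-- cases reduce to `false`.
∑-𝟙-≟ : (i : Fin n) → ∑[ j < n ] 𝟙 (i ≟ j) ≡ 1
∑-𝟙-≟ {suc n} zero    = cong suc (sum-replicate-zero n)
∑-𝟙-≟ {suc n} (suc i) = ∑-𝟙-≟ i

fixedPoints : (Fin n → Fin n) → ℕ
fixedPoints {n} f = ∑[ x < n ] 𝟙 (f x ≟ x)

fixedPoints-id : (f : Fin n → Fin n) → (∀ x → f x ≡ x) → fixedPoints f ≡ n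
fixedPoints-id {n} f f≗id = begin
  fixedPoints f   ≡⟨ sum-cong-≗ (λ x → 𝟙-true (f x ≟ x) (f≗id x)) ⟩
  ∑[ x < n ] 1    ≡⟨ sum-const n 1 ⟩
  n * 1           ≡⟨ ℕ.*-identityʳ n ⟩
  n               ∎
  where open ≡-Reasoning

1≤fixedPoints : (f : Fin n → Fin n) → ∃[ x ] f x ≡ x → 1 ≤ fixedPoints f
1≤fixedPoints f (x , fx≡x) = ℕ.≤-trans
  (ℕ.≤-reflexive (sym (𝟙-true (f x ≟ x) fx≡x)))
  (term≤sum (λ y → 𝟙 (f y ≟ y)) x)

-- Double counting for a weighted family of self-maps.

module _ .{{_ : NonZero n}} (w : Fin m → ℕ) (φ : Fin m → Fin n → Fin n) where

  -- When `w` is the indicator of a set of indices, this counts the indices `k` in the set whose map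
  -- sends `x` to `y`. Weights of 0 and 1 make it possible to sum over all indices without
  -- enumerating the set.
  transports : Fin n → Fin n → ℕ
  transports x y = ∑[ k < m ] (w k * 𝟙 (φ k x ≟ y))

  -- Each map sends `x` to exactly one point, so after exchanging the sums the index `k` contributes
  -- `w k` once.
  ∑-transports : ∀ x → ∑[ y < n ] transports x y ≡ sum w
  ∑-transports x = begin
    ∑[ y < n ] ∑[ k < m ] (w k * 𝟙 (φ k x ≟ y))
      ≡⟨ ∑-comm (λ y k → w k * 𝟙 (φ k x ≟ y)) ⟩
    ∑[ k < m ] ∑[ y < n ] (w k * 𝟙 (φ k x ≟ y))
      ≡⟨ sum-cong-≗ (λ k → *-distribˡ-sum (w k) (λ y → 𝟙 (φ k x ≟ y))) ⟨
    ∑[ k < m ] (w k * ∑[ y < n ] 𝟙 (φ k x ≟ y))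
      ≡⟨ sum-cong-≗ (λ k → cong (w k *_) (∑-𝟙-≟ (φ k x))) ⟩
    ∑[ k < m ] (w k * 1)
      ≡⟨ sum-cong-≗ (λ k → ℕ.*-identityʳ (w k)) ⟩
    sum w ∎
    where open ≡-Reasoning

  burnside : (∀ x y → transports x y ≡ transports x x) →
             ∑[ k < m ] (w k * fixedPoints (φ k)) ≡ sum w
  burnside homogeneous = trans
    (begin
      ∑[ k < m ] (w k * fixedPoints (φ k))
        ≡⟨ sum-cong-≗ (λ k → *-distribˡ-sum (w k) (λ x → 𝟙 (φ k x ≟ x))) ⟩
      ∑[ k < m ] ∑[ x < n ] (w k * 𝟙 (φ k x ≟ x))
        ≡⟨ ∑-comm (λ k x → w k * 𝟙 (φ k x ≟ x)) ⟩
      ∑[ x < n ] transports x x ∎)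
    -- Multiplying by `n` replaces division: by homogeneity, `n` copies of a diagonal entry make up
    -- its whole row, and every row sums to `sum w`.
    (ℕ.*-cancelˡ-≡ _ _ n (begin
      n * ∑[ x < n ] transports x x
        ≡⟨ *-distribˡ-sum n (λ x → transports x x) ⟩
      ∑[ x < n ] (n * transports x x)
        ≡⟨ sum-cong-≗ (λ x → sum-const n (transports x x)) ⟨
      ∑[ x < n ] ∑[ y < n ] transports x x
        ≡⟨ sum-cong-≗ (λ x → sum-cong-≗ (λ y → homogeneous x y)) ⟨
      ∑[ x < n ] ∑[ y < n ] transports x y
        ≡⟨ sum-cong-≗ ∑-transports ⟩
      ∑[ x < n ] sum w
        ≡⟨ sum-const n (sum w) ⟩
      n * sum w ∎))
    where open ≡-Reasoning

-- Finite function spaces and double negation.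

funToFin-cong : {f g : Fin m → Fin n} → f ≗ g → funToFin f ≡ funToFin g
funToFin-cong {zero}  f≗g = refl
funToFin-cong {suc m} f≗g = cong₂ combine (f≗g zero) (funToFin-cong (f≗g ∘ suc))

-- Double negation is applicative, so it commutes with a quantifier over the finite type `Fin n`.
∀-dec-¬¬ : (P : Fin n → Set a) → ¬ ¬ (∀ i → Dec (P i))
∀-dec-¬¬ P = sequence (RawMonad.rawApplicative ¬¬-Monad) (λ _ → ¬¬-excluded-middle)

-- The image of the group in the self-maps of `Fin n`.

module _ (G : Group c ℓ) where

  open Group G using (Carrier; _≈_; _∙_; ε; _⁻¹; inverseˡ; inverseʳ)

  module _
    (_·_ : Carrier → Fin n → Fin n)
    (·-cong : ∀ {g h} → g ≈ h → ∀ x → g · x ≡ h · x)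
    (·-identity : ∀ x → ε · x ≡ x)
    (·-assoc : ∀ g h x → (g ∙ h) · x ≡ g · (h · x))
    where

    private
      ·-inverseˡ : ∀ g x → (g ⁻¹) · (g · x) ≡ x
      ·-inverseˡ g x = trans (sym (·-assoc (g ⁻¹) g x))
        (trans (·-cong (inverseˡ g) x) (·-identity x))

      ·-inverseʳ : ∀ g x → g · ((g ⁻¹) · x) ≡ x
      ·-inverseʳ g x = trans (sym (·-assoc g (g ⁻¹) x))
        (trans (·-cong (inverseʳ g) x) (·-identity x))

      ·-injective : ∀ g {x y} → g · x ≡ g · y → x ≡ y
      ·-injective g {x} {y} eq =
        trans (sym (·-inverseˡ g x)) (trans (cong ((g ⁻¹) ·_) eq) (·-inverseˡ g y))

      fun : Fin (n ^ n) → Fin n → Fin n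
      fun = finToFun

      -- Numbers below `n ^ n` serve as codes of self-maps. Group elements that act alike share one
      -- code, so the count stays finite whatever the size of the group.
      Image : Fin (n ^ n) → Set _
      Image k = ∃[ g ] (∀ x → g · x ≡ fun k x)

      translate : Carrier → Fin (n ^ n) → Fin (n ^ n)
      translate g k = funToFin (λ x → g · fun k x)

      fun-translate : ∀ g k x → fun (translate g k) x ≡ g · fun k x
      fun-translate g k = finToFun-funToFin (λ x → g · fun k x)

      -- Stated for any `g` and `h` with `g` undoing `h`, so that it yields both inverse laws of
      -- `translation`.
      translate-inverse : ∀ g h → (∀ x → g · (h · x) ≡ x) →
                          ∀ k → translate g (translate h k) ≡ k
      translate-inverse g h gh≗id k = trans
        (funToFin-cong (λ x → trans (cong (g ·_) (fun-translate h k x)) (gh≗id (fun k x))))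
        (funToFin-finToFin {n} {n} k)

      translation : Carrier → Permutation′ (n ^ n)
      translation g = permutation (translate g) (translate (g ⁻¹))
        (translate-inverse g (g ⁻¹) (·-inverseʳ g))
        (translate-inverse (g ⁻¹) g (·-inverseˡ g))

      Image-translate : ∀ g k → Image (translate g k) ⇔ Image k
      Image-translate g k = mk⇔
        (λ (h , h≗) → g ⁻¹ ∙ h , λ x → trans (·-assoc (g ⁻¹) h x)
          (trans (cong ((g ⁻¹) ·_) (trans (h≗ x) (fun-translate g k x)))
            (·-inverseˡ g (fun k x))))
        (λ (h , h≗) → g ∙ h , λ x → trans (·-assoc g h x)
          (trans (cong (g ·_) (h≗ x)) (sym (fun-translate g k x))))

      module _ (Image? : ∀ k → Dec (Image k)) where

        weight : Fin (n ^ n) → ℕ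
        weight k = 𝟙 (Image? k)

        -- Reindex the sum along the permutation `translation g`. It preserves membership in the
        -- image, and it turns the condition of reaching `g · y` into that of reaching `y`, since
        -- `g` acts injectively.
        transports-translate : .{{_ : NonZero n}} → ∀ g x y →
          transports weight fun x (g · y) ≡ transports weight fun x y
        transports-translate g x y = trans
          (∑-permute (λ k → weight k * 𝟙 (fun k x ≟ g · y)) (translation g))
          (sum-cong-≗ λ k → cong₂ _*_
            (𝟙-cong (Image-translate g k) (Image? (translate g k)) (Image? k))
            (𝟙-cong
              (mk⇔ (λ eq → ·-injective g (trans (sym (fun-translate g k x)) eq))
                   (λ eq → trans (fun-translate g k x) (cong (g ·_) eq)))
              (fun (translate g k) x ≟ g · y) (fun k x ≟ y)))

        decidable-rotarilyTransitive⇒n≡1 : RotarilyTransitive _·_ → n ≡ 1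
        decidable-rotarilyTransitive⇒n≡1 (transitive , rotations) = begin
          n                                ≡⟨ fixedPoints-id (fun e) fun-e ⟨
          fixedPoints (fun e)              ≡⟨ ℕ.*-identityˡ _ ⟨
          1 * fixedPoints (fun e)          ≡⟨ cong (_* fixedPoints (fun e)) weight-e ⟨
          weight e * fixedPoints (fun e)   ≡⟨ tight e ⟨
          weight e                         ≡⟨ weight-e ⟩
          1                                ∎
          where
          open ≡-Reasoning

          -- The identity has a fixed point, so there is at least one point.
          instance
            n≢0 : NonZero n
            n≢0 = nonZeroIndex (proj₁ (rotations ε))

          e : Fin (n ^ n)
          e = funToFin {n} {n} id

          fun-e : ∀ x → fun e x ≡ x
          fun-e = finToFun-funToFin id

          weight-e : weight e ≡ 1
          weight-e = 𝟙-true (Image? e) (ε , λ x → trans (·-identity x) (sym (fun-e x)))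

          homogeneous : ∀ x y → transports weight fun x y ≡ transports weight fun x x
          -- Transitivity gives `g` moving `x` to `y`, so `y` may be taken to be `g · x`.
          homogeneous x y with g , refl ← transitive x y = transports-translate g x x

          -- Outside the image the weight is 0. Inside, some `g` acts as `fun k`, and the fixed
          -- point of `g` makes the second factor at least 1.
          weight≤ : ∀ k → weight k ≤ weight k * fixedPoints (fun k)
          weight≤ k with Image? k
          ... | no  _        = z≤n
          ... | yes (g , g≗) = ℕ.≤-trans
            (1≤fixedPoints (fun k) (let x , gx≡x = rotations g in x , trans (sym (g≗ x)) gx≡x))
            (ℕ.≤-reflexive (sym (ℕ.*-identityˡ _)))

          tight : ∀ k → weight k ≡ weight k * fixedPoints (fun k)
          -- `burnside` equates the totals of the two sides of `weight≤`.
          tight = sum-mono-≤-tight _ _ weight≤ (sym (burnside weight fun homogeneous))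

    rotarilyTransitive⇒n≡1 : RotarilyTransitive _·_ → n ≡ 1
    rotarilyTransitive⇒n≡1 rotarilyTransitive = decidable-stable (n ℕ.≟ 1)
      (¬¬-map (λ Image? → decidable-rotarilyTransitive⇒n≡1 Image? rotarilyTransitive)
              (∀-dec-¬¬ Image))

proposition1p1 : ∀ {a e c ℓ} (𝒢 : Graph a e) → Finite (Graph.V 𝒢) →
    RotarilyTransitiveGraph c ℓ 𝒢 → HasCardinality (Graph.V 𝒢) 1
proposition1p1 𝒢 (n , V⤖Fin) (G , α , transitive , rotations) =
  -- The action is conjugated by the numbering of the vertices to an action on `Fin n`. In a product
  -- the inner `from` and `to` cancel, and a fixed vertex `v` becomes the fixed point `to v`.
  subst (HasCardinality V) (rotarilyTransitive⇒n≡1 G _◂_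
    (λ g≈h i → cong to (ρ-cong g≈h (from i)))
    (λ i → trans (cong to (ρ-ε (from i))) (to∘from′ i))
    (λ g h i → cong to (trans (ρ-∙ g h (from i)) (cong (g ·_) (sym (from∘to′ _)))))
    ( (λ i j → let g , eq = transitive (from i) (from j) in g , trans (cong to eq) (to∘from′ j))
    , (λ g → let v , eq = rotations g in
        to v , cong to (trans (cong (g ·_) (from∘to′ v)) eq))
    )) V⤖Fin
  where
  open Graph 𝒢 using (V)
  open GraphAction α using (ρ; isHomomorphism; _·_)
  open GroupMorphisms.IsGroupHomomorphism isHomomorphism
    using () renaming (⟦⟧-cong to ρ-cong; ε-homo to ρ-ε; homo to ρ-∙)
  open Bijection V⤖Fin using (to; injective; surjective)

  from : Fin n → V
  from = Bijection.to (⤖-sym V⤖Fin)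

  to∘from′ : ∀ i → to (from i) ≡ i
  to∘from′ i = proj₂ (surjective i) refl

  from∘to′ : ∀ v → from (to v) ≡ v
  from∘to′ v = injective (to∘from′ (to v))

  _◂_ : Group.Carrier G → Fin n → Fin n
  g ◂ i = to (g · from i)
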